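{- Let $G$ be an $n$-vertex digraph which is an orientation of a connected simple graph containing exactly one cycle, and suppose $G$ has no sources. Then $G$ has a quasi-kernel with at most $\frac{n+2}{3}$ vertices. Moreover, the bound is sharp: for every $n\ge 4$ with $n\equiv 1\pmod 3$, the cyclically oriented cycle on $n$ vertices has no quasi-kernel with fewer than $\frac{n+2}{3}$ vertices.
   Context: Digraphs are finite, without loops and without multiple edges in the same direction. A source is a vertex of in-degree $0$. For $V'\subseteq V(G)$, $\Gamma^+(V')$ is the set of out-neighbours of vertices of $V'$ and $\Gamma^+_2(V')=V'\cup\Gamma^+(V')\cup\Gamma^+(\Gamma^+(V'))$. A quasi-kernel is an independent set $Q$ with $\Gamma^+_2(Q)=V(G)$. -}

module Defs where

open import Data.Fin using (Fin; toℕ; _≟_)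
open import Data.Fin.Properties using (toℕ-fromℕ<; toℕ<n)
open import Data.Fin.Subset using (Subset; ∣_∣; _∈_)
open import Data.Nat using (ℕ; suc; _≤_; _<_; s≤s)
open import Data.Nat.DivMod using (_mod_; _%_; m%n<n; m<n⇒m%n≡m; n%n≡0)
open import Data.Nat.Properties using (m≤n⇒m<n∨m≡n; 1+n≢n)
open import Data.Product using (Σ; ∃; _×_)
open import Data.Sum using (_⊎_; inj₁; inj₂)
open import Data.Vec using (tabulate)
open import Function.Bundles using (_⇔_)
open import Function.Definitions using (Injective)
open import Level using (0ℓ)
open import Relation.Binary.Construct.Closure.ReflexiveTransitive using (Star)
open import Relation.Binary.Core using (Rel)
open import Relation.Binary.Definitions using (Asymmetric; Decidable; Irreflexive; Symmetric)
open import Relation.Binary.PropositionalEquality using (_≡_; refl; sym; trans; cong)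
open import Relation.Nullary using (¬_; does)
open import Relation.Unary using (Pred; _∪_)

record Digraph (n : ℕ) : Set₁ where
  infix 4 _⟶_ _⟶?_
  field
    _⟶_      : Rel (Fin n) 0ℓ
    _⟶?_     : Decidable _⟶_
    loopless : Irreflexive _≡_ _⟶_

record SimpleGraph (n : ℕ) : Set₁ where
  infix 4 _—_ _—?_
  field
    _—_       : Rel (Fin n) 0ℓ
    _—?_      : Decidable _—_
    symmetric : Symmetric _—_
    loopless  : Irreflexive _≡_ _—_

record IsOrientationOf {n : ℕ} (G : Digraph n) (H : SimpleGraph n) : Set where
  open Digraph G using (_⟶_)
  open SimpleGraph H using (_—_)
  field
    arc⇒edge   : ∀ {u v} → u ⟶ v → u — v
    edge⇒arc   : ∀ {u v} → u — v → u ⟶ v ⊎ v ⟶ u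
    asymmetric : Asymmetric _⟶_

-- Cyclic successor: i ↦ i + 1 modulo n.
next : ∀ {n} → Fin n → Fin n
next {suc n} i = suc (toℕ i) mod suc n

module _ {n : ℕ} (H : SimpleGraph n) where
  open SimpleGraph H using (_—_)

  Connected : Set
  Connected = ∀ u v → Star _—_ u v

  record Cycle : Set where
    field
      len       : ℕ
      3≤len     : 3 ≤ len
      vertex    : Fin len → Fin n
      injective : Injective _≡_ _≡_ vertex
      adjacent  : ∀ i → vertex i — vertex (next i)

    HasEdge : Rel (Fin n) 0ℓ
    HasEdge u v = ∃ λ i → (u ≡ vertex i × v ≡ vertex (next i))
                        ⊎ (u ≡ vertex (next i) × v ≡ vertex i)

  -- A cycle is a subgraph: the choice of starting vertex and direction of
  -- traversal in `vertex` is forgotten by comparing edge sets.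
  SameCycle : Rel Cycle 0ℓ
  SameCycle C D = ∀ u v → Cycle.HasEdge C u v ⇔ Cycle.HasEdge D u v

  ExactlyOneCycle : Set
  ExactlyOneCycle = Σ Cycle λ C → ∀ D → SameCycle D C

module _ {n : ℕ} (G : Digraph n) where
  open Digraph G

  inNeighbours : Fin n → Subset n
  inNeighbours v = tabulate λ u → does (u ⟶? v)

  inDegree : Fin n → ℕ
  inDegree v = ∣ inNeighbours v ∣

  IsSource : Pred (Fin n) 0ℓ
  IsSource v = inDegree v ≡ 0

  Γ⁺ : Pred (Fin n) 0ℓ → Pred (Fin n) 0ℓ
  Γ⁺ S v = ∃ λ u → S u × u ⟶ v

  Γ₂⁺ : Pred (Fin n) 0ℓ → Pred (Fin n) 0ℓ
  Γ₂⁺ S = S ∪ (Γ⁺ S ∪ Γ⁺ (Γ⁺ S))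

  Independent : Pred (Subset n) 0ℓ
  Independent Q = ∀ {u v} → u ∈ Q → v ∈ Q → ¬ (u ⟶ v)

  record IsQuasiKernel (Q : Subset n) : Set where
    field
      independent : Independent Q
      covers      : ∀ v → Γ₂⁺ (_∈ Q) v

next-irreflexive : ∀ {n} → 3 ≤ n → (i : Fin n) → ¬ (i ≡ next i)
next-irreflexive {suc m} 3≤n i i≡next = go (m≤n⇒m<n∨m≡n (toℕ<n i))
  where
  eq : toℕ i ≡ suc (toℕ i) % suc m
  eq = trans (cong toℕ i≡next) (toℕ-fromℕ< (m%n<n (suc (toℕ i)) (suc m)))

  absurd : ∀ {k} → k ≡ 0 → suc k ≡ suc m → ¬ (3 ≤ suc m)
  absurd refl refl (s≤s ())

  go : ¬ (suc (toℕ i) < suc m ⊎ suc (toℕ i) ≡ suc m)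
  go (inj₁ lt) = 1+n≢n (sym (trans eq (m<n⇒m%n≡m lt)))
  go (inj₂ e)  = absurd (trans eq (trans (cong (_% suc m) e) (n%n≡0 (suc m)))) e 3≤n

-- The cyclically oriented cycle 0 → 1 → ⋯ → n-1 → 0.
directedCycle : (n : ℕ) → 3 ≤ n → Digraph n
directedCycle n 3≤n = record
  { _⟶_      = λ i j → j ≡ next i
  ; _⟶?_     = λ i j → j ≟ next i
  ; loopless = λ { {i} refl i≡next → next-irreflexive 3≤n i i≡next }
  }

{-# OPTIONS --safe #-}
-- In G every vertex has in-degree exactly 1: choose an in-neighbour p v of each
-- vertex v; following p from anywhere ends in a cycle, which must be the only
-- one, and any arc other than the arcs p v → v would close a second cycle.  So
-- G is a directed cycle of length k with out-trees attached to it.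
--
-- Choose e ≤ 2 pairwise non-adjacent "doubled" vertices on the cycle with
-- 3 ∣ k + e, and imagine a dummy vertex inserted just before each of them.  The
-- enlarged digraph maps homomorphically to the directed triangle; each of its
-- three colour classes, with the dummies identified with the doubled vertices
-- they precede, is a quasi-kernel of G.  Their sizes add up to n + e ≤ n + 2.
--
-- For the sharpness, Q covers at most 3 ∣ Q ∣ vertices of a directed cycle.
module Submission where

open import Defs
open import Data.Bool using (Bool; true; false)
open import Data.Fin using (Fin; zero; suc; toℕ; _≟_)
open import Data.Fin.Patterns using (0F; 1F; 2F)
open import Data.Fin.Properties using (pigeonhole; toℕ-injective; toℕ-fromℕ<; toℕ<n)
open import Data.Fin.Subset using (Subset; ∣_∣; _∈_; _∉_; _∪_; _∩_; ⁅_⁆; ⊤; ⊥; inside; outside)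
open import Data.Fin.Subset.Properties
  using (_∈?_; ∉⊥; ∣⊥∣≡0; ∣⊤∣≡n; ∣⁅x⁆∣≡1; x∈⁅x⁆; x∈⁅y⁆⇒x≡y; x≢y⇒x∉⁅y⁆;
         x∈p∪q⁺; x∈p∪q⁻; x∈p∩q⁺; x∈p∩q⁻; p⊆q⇒∣p∣≤∣q∣; ∩-identityˡ)
open import Data.List using (List; []; _∷_; length; lookup)
open import Data.List.Membership.Propositional using () renaming (_∈_ to _∈ˡ_; _∉_ to _∉ˡ_)
open import Data.List.Membership.Propositional.Properties using (∈-lookup)
open import Data.List.Relation.Unary.Any using (here; there)
open import Data.Nat using (ℕ; zero; suc; _+_; _*_; _≤_; _<_; z≤n; s≤s; _≤?_)
open import Data.Nat.DivMod using (_%_; _/_; m<n⇒m%n≡m; n%n≡0; m%n<n; m≡m%n+[m/n]*n)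
open import Data.Nat.Properties hiding (_≟_)
open import Data.Nat.Tactic.RingSolver using (solve-∀)
open import Data.Product using (∃; _×_; _,_; proj₁; proj₂)
open import Data.Sum using (_⊎_; inj₁; inj₂; [_,_]′)
open import Data.Vec using ([]; _∷_; tabulate)
open import Data.Vec.Properties using (lookup∘tabulate; lookup⇒[]=; []=⇒lookup)
open import Function using (_∘_)
open import Function.Bundles using (Equivalence)
open import Function.Definitions using (Injective)
open import Level using (0ℓ)
open import Relation.Binary.Construct.Closure.ReflexiveTransitive
  using (Star; ε; _◅_; _◅◅_) renaming (map to mapStar; reverse to reverseStar)
open import Relation.Binary.Core using (Rel)
open import Relation.Binary.Definitions using (Asymmetric)
open import Relation.Binary.PropositionalEquality
  using (_≡_; _≢_; refl; sym; trans; cong; cong₂; subst)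
open import Relation.Nullary using (¬_; yes; no; does; contradiction)
open import Relation.Nullary.Decidable using (dec-true)
import Data.List.Membership.DecPropositional as DecMembership
import Data.Vec as Vec

-- Cardinalities of subsets

∣p∪q∣≤∣p∣+∣q∣ : ∀ {n} (p q : Subset n) → ∣ p ∪ q ∣ ≤ ∣ p ∣ + ∣ q ∣
∣p∪q∣≤∣p∣+∣q∣ []            []            = z≤n
∣p∪q∣≤∣p∣+∣q∣ (outside ∷ p) (outside ∷ q) = ∣p∪q∣≤∣p∣+∣q∣ p q
∣p∪q∣≤∣p∣+∣q∣ (outside ∷ p) (inside ∷ q)  =
  ≤-trans (s≤s (∣p∪q∣≤∣p∣+∣q∣ p q)) (≤-reflexive (sym (+-suc ∣ p ∣ ∣ q ∣)))
∣p∪q∣≤∣p∣+∣q∣ (inside ∷ p)  (outside ∷ q) = s≤s (∣p∪q∣≤∣p∣+∣q∣ p q)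
∣p∪q∣≤∣p∣+∣q∣ (inside ∷ p)  (inside ∷ q)  =
  s≤s (≤-trans (∣p∪q∣≤∣p∣+∣q∣ p q) (+-monoʳ-≤ ∣ p ∣ (n≤1+n ∣ q ∣)))

image : ∀ {m n} → (Fin m → Fin n) → Subset m → Subset n
image f []            = ⊥
image f (outside ∷ p) = image (f ∘ suc) p
image f (inside ∷ p)  = ⁅ f zero ⁆ ∪ image (f ∘ suc) p

∈-image : ∀ {m n} (f : Fin m → Fin n) {p x} → x ∈ p → f x ∈ image f p
∈-image f {inside ∷ p}  {zero}  Vec.here        = x∈p∪q⁺ (inj₁ (x∈⁅x⁆ _))
∈-image f {outside ∷ p} {suc x} (Vec.there x∈p) = ∈-image (f ∘ suc) x∈p
∈-image f {inside ∷ p}  {suc x} (Vec.there x∈p) = x∈p∪q⁺ (inj₂ (∈-image (f ∘ suc) x∈p))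

∣image∣≤ : ∀ {m n} (f : Fin m → Fin n) p → ∣ image f p ∣ ≤ ∣ p ∣
∣image∣≤ {n = n} f [] = ≤-reflexive (∣⊥∣≡0 n)
∣image∣≤ f (outside ∷ p) = ∣image∣≤ (f ∘ suc) p
∣image∣≤ f (inside ∷ p)  = ≤-trans (∣p∪q∣≤∣p∣+∣q∣ ⁅ f zero ⁆ (image (f ∘ suc) p))
  (+-mono-≤ (≤-reflexive (∣⁅x⁆∣≡1 (f zero))) (∣image∣≤ (f ∘ suc) p))

fibre : ∀ {m n} → (Fin n → Fin m) → Fin m → Subset n
fibre c j = tabulate λ v → does (c v ≟ j)

∈-fibre⁺ : ∀ {m n} (c : Fin n → Fin m) {j v} → c v ≡ j → v ∈ fibre c j
∈-fibre⁺ c {j} {v} cv≡j =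
  lookup⇒[]= v _ (trans (lookup∘tabulate _ v) (dec-true (c v ≟ j) cv≡j))

∈-fibre⁻ : ∀ {m n} (c : Fin n → Fin m) {j v} → v ∈ fibre c j → c v ≡ j
∈-fibre⁻ c {j} {v} v∈ with c v ≟ j | trans (sym (lookup∘tabulate (λ v → does (c v ≟ j)) v)) ([]=⇒lookup v∈)
... | yes cv≡j | _ = cv≡j
... | no _     | ()

sum-fibres : ∀ {n} (p : Subset n) (c : Fin n → Fin 3) →
  ∣ p ∩ fibre c 0F ∣ + ∣ p ∩ fibre c 1F ∣ + ∣ p ∩ fibre c 2F ∣ ≡ ∣ p ∣
sum-fibres []            c = refl
sum-fibres (outside ∷ p) c = sum-fibres p (c ∘ suc)
sum-fibres (inside ∷ p)  c with c zero | sum-fibres p (c ∘ suc)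
... | 0F | ih = cong suc ih
... | 1F | ih = trans (cong (_+ ∣ p ∩ fibre (c ∘ suc) 2F ∣)
                        (+-suc ∣ p ∩ fibre (c ∘ suc) 0F ∣ ∣ p ∩ fibre (c ∘ suc) 1F ∣))
                      (cong suc ih)
... | 2F | ih = trans (+-suc (∣ p ∩ fibre (c ∘ suc) 0F ∣ + ∣ p ∩ fibre (c ∘ suc) 1F ∣)
                             ∣ p ∩ fibre (c ∘ suc) 2F ∣)
                      (cong suc ih)

-- Averaging: three failures would add up to `3 * m < 3 * (a + b + c)`.
min-of-three : ∀ a b c {m} → a + b + c ≤ m → 3 * a ≤ m ⊎ 3 * b ≤ m ⊎ 3 * c ≤ m
min-of-three a b c {m} sum≤m with 3 * a ≤? m | 3 * b ≤? m | 3 * c ≤? m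
... | yes a≤ | _      | _      = inj₁ a≤
... | no _   | yes b≤ | _      = inj₂ (inj₁ b≤)
... | no _   | no _   | yes c≤ = inj₂ (inj₂ c≤)
... | no a≰  | no b≰  | no c≰  = contradiction total (<⇒≱ big)
  where
  regroup : ∀ x y z → 3 * x + 3 * y + 3 * z ≡ 3 * (x + y + z)
  regroup = solve-∀

  triple : ∀ x → x + x + x ≡ 3 * x
  triple = solve-∀

  total : 3 * a + 3 * b + 3 * c ≤ 3 * m
  total = ≤-trans (≤-reflexive (regroup a b c)) (*-monoʳ-≤ 3 sum≤m)

  big : 3 * m < 3 * a + 3 * b + 3 * c
  big = subst (_< 3 * a + 3 * b + 3 * c) (triple m)
          (+-mono-< (+-mono-< (≰⇒> a≰) (≰⇒> b≰)) (≰⇒> c≰))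

-- The cyclic successor

next-step : ∀ {n} {i j : Fin n} → toℕ j ≡ suc (toℕ i) → next i ≡ j
next-step {suc n} {i} {j} j≡1+i = toℕ-injective
  (trans (toℕ-fromℕ< (m%n<n (suc (toℕ i)) (suc n)))
  (trans (m<n⇒m%n≡m (subst (_< suc n) j≡1+i (toℕ<n j))) (sym j≡1+i)))

next-wrap : ∀ {n} {i : Fin (suc n)} → suc (toℕ i) ≡ suc n → next i ≡ zero
next-wrap {n} {i} i≡n = toℕ-injective
  (trans (toℕ-fromℕ< (m%n<n (suc (toℕ i)) (suc n)))
  (trans (cong (_% suc n) i≡n) (n%n≡0 (suc n))))

next³ : (j : Fin 3) → next (next (next j)) ≡ j
next³ 0F = refl
next³ 1F = refl
next³ 2F = refl

next₃-injective : {a b : Fin 3} → next a ≡ next b → a ≡ b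
next₃-injective {a} {b} e = trans (sym (next³ a)) (trans (cong (next ∘ next) e) (next³ b))

next₃-≢ : (j : Fin 3) → j ≢ next j
next₃-≢ = next-irreflexive ≤-refl

next²₃-≢ : (j : Fin 3) → j ≢ next (next j)
next²₃-≢ j e = next₃-≢ j (trans (sym (next³ j)) (cong next (sym e)))

next₃-cover : (a b : Fin 3) → a ≡ b ⊎ a ≡ next b ⊎ a ≡ next (next b)
next₃-cover 0F 0F = inj₁ refl
next₃-cover 1F 0F = inj₂ (inj₁ refl)
next₃-cover 2F 0F = inj₂ (inj₂ refl)
next₃-cover 0F 1F = inj₂ (inj₂ refl)
next₃-cover 1F 1F = inj₁ refl
next₃-cover 2F 1F = inj₂ (inj₁ refl)
next₃-cover 0F 2F = inj₂ (inj₁ refl)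
next₃-cover 1F 2F = inj₂ (inj₂ refl)
next₃-cover 2F 2F = inj₁ refl

-- Simple paths and cycles

module _ {n : ℕ} (R : Rel (Fin n) 0ℓ) where

  -- The visited vertices are kept as an index, so that `lookup xs` can serve as the vertex map of a
  -- `Cycle`.
  data SimplePath : Fin n → Fin n → List (Fin n) → Set where
    stop : ∀ {v} → SimplePath v v (v ∷ [])
    step : ∀ {u w v xs} → R u w → u ∉ˡ xs → SimplePath w v xs → SimplePath u v (u ∷ xs)

module _ {n : ℕ} {R : Rel (Fin n) 0ℓ} where
  open DecMembership (_≟_ {n}) using () renaming (_∈?_ to _∈ˡ?_)

  suffixFrom : ∀ {u w v xs} → u ∈ˡ xs → SimplePath R w v xs → ∃ (SimplePath R u v)
  suffixFrom (here refl) stop             = _ , stop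
  suffixFrom (here refl) path@(step _ _ _) = _ , path
  suffixFrom (there u∈)  (step _ _ path)  = suffixFrom u∈ path

  -- If the new first vertex already occurs on the simplified remainder, the detour is dropped by
  -- restarting at that occurrence.
  eraseLoops : ∀ {u v} → Star R u v → ∃ (SimplePath R u v)
  eraseLoops ε = _ , stop
  eraseLoops {u} (r ◅ walk) with eraseLoops walk
  ... | xs , path with u ∈ˡ? xs
  ...   | yes u∈xs = suffixFrom u∈xs path
  ...   | no  u∉xs = _ , step r u∉xs path

  lookup-injective : ∀ {u v xs} → SimplePath R u v xs → Injective _≡_ _≡_ (lookup xs)
  lookup-injective stop {zero} {zero} _ = refl
  lookup-injective (step _ _ _) {zero} {zero} _ = refl
  lookup-injective (step {xs = xs} _ u∉ _) {zero} {suc j} e =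
    contradiction (subst (_∈ˡ xs) (sym e) (∈-lookup j)) u∉
  lookup-injective (step {xs = xs} _ u∉ _) {suc i} {zero} e =
    contradiction (subst (_∈ˡ xs) e (∈-lookup i)) u∉
  lookup-injective (step _ _ path) {suc i} {suc j} e = cong suc (lookup-injective path e)

  reach-lookup : ∀ {u v xs} → SimplePath R u v xs → ∀ i → Star R u (lookup xs i)
  reach-lookup stop            zero    = ε
  reach-lookup (step _ _ _)    zero    = ε
  reach-lookup (step r _ path) (suc i) = r ◅ reach-lookup path i

  lookup-last : ∀ {u v xs} → SimplePath R u v xs →
    ∃ λ i → suc (toℕ i) ≡ length xs × lookup xs i ≡ v
  lookup-last stop = zero , refl , refl
  lookup-last (step _ _ path) with i , i≡ , e ← lookup-last path = suc i , cong suc i≡ , e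

  lookup-next : ∀ {u v xs} → SimplePath R u v xs → ∀ i →
    (suc (toℕ i) ≡ length xs × lookup xs i ≡ v)
    ⊎ ∃ λ j → toℕ j ≡ suc (toℕ i) × R (lookup xs i) (lookup xs j)
  lookup-next stop                           zero = inj₁ (refl , refl)
  lookup-next (step r _ stop)                zero = inj₂ (suc zero , refl , r)
  lookup-next (step r _ (step _ _ _))        zero = inj₂ (suc zero , refl , r)
  lookup-next (step _ _ path) (suc i) with lookup-next path i
  ... | inj₁ (i≡ , e)     = inj₁ (cong suc i≡ , e)
  ... | inj₂ (j , j≡ , r) = inj₂ (suc j , cong suc j≡ , r)

  module _ {u v : Fin n} where

    lookup-wrap : ∀ {xs} → SimplePath R u v xs → ∀ i → suc (toℕ i) ≡ length xs →
      lookup xs (next i) ≡ u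
    -- Matching on the path shows that `xs` is a cons, so that its length is a successor as
    -- `next-wrap` demands.
    lookup-wrap stop                      i i≡ = cong (lookup _) (next-wrap {i = i} i≡)
    lookup-wrap (step {xs = xs} _ _ path) i i≡ = cong (lookup (u ∷ xs)) (next-wrap {i = i} i≡)

    lookup-next-cyclic : ∀ {xs} → SimplePath R u v xs → ∀ i →
      R (lookup xs i) (lookup xs (next i)) ⊎ (lookup xs i ≡ v × lookup xs (next i) ≡ u)
    lookup-next-cyclic {xs} path i with lookup-next path i
    ... | inj₁ (i≡ , e)     = inj₂ (e , lookup-wrap path i i≡)
    ... | inj₂ (j , j≡ , r) = inj₁ (subst (R (lookup xs i) ∘ lookup xs) (sym (next-step j≡)) r)

    -- A path with one vertex would force `u ≡ v`, and one with two vertices would be a single step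
    -- `R u v`.
    3≤length : ∀ {xs} → SimplePath R u v xs → u ≢ v → ¬ R u v → 3 ≤ length xs
    3≤length stop                                 u≢v _   = contradiction refl u≢v
    3≤length (step r _ stop)                      _   ¬uv = contradiction r ¬uv
    3≤length (step _ _ (step _ _ stop))           _   _   = s≤s (s≤s (s≤s z≤n))
    3≤length (step _ _ (step _ _ (step _ _ _)))   _   _   = s≤s (s≤s (s≤s z≤n))

  -- A cycle made of an `R`-path from `u` to `v` and the closing edge from `v` back to `u`. The
  -- closing edge is the only one that need not come from `R`.
  record ClosedBy (H : SimpleGraph n) (u v : Fin n) : Set where
    field
      cycle     : Cycle H
    open Cycle cycle
    field
      hasEdge   : HasEdge v u
      reachable : ∀ i → Star R u (vertex i)
      edges     : ∀ i → R (vertex i) (vertex (next i)) ⊎ (vertex i ≡ v × vertex (next i) ≡ u)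

  closeWalk : (H : SimpleGraph n) →
    (∀ {x y} → R x y → SimpleGraph._—_ H x y) →
    ∀ {u v} → SimpleGraph._—_ H v u → u ≢ v → ¬ R u v → Star R u v → ClosedBy H u v
  closeWalk H R⇒— {u} {v} v—u u≢v ¬uv walk
    with xs , path ← eraseLoops walk = record
    { cycle = record
      { len       = length xs
      ; 3≤len     = 3≤length path u≢v ¬uv
      ; vertex    = lookup xs
      ; injective = lookup-injective path
      ; adjacent  = λ i → adjacent i (lookup-next-cyclic path i)
      }
    ; hasEdge   = lastEdge
    ; reachable = reach-lookup path
    ; edges     = lookup-next-cyclic path
    }
    where
    open SimpleGraph H

    adjacent : ∀ i → R (lookup xs i) (lookup xs (next i)) ⊎ (lookup xs i ≡ v × lookup xs (next i) ≡ u) →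
      lookup xs i — lookup xs (next i)
    adjacent i (inj₁ r) = R⇒— r
    adjacent i (inj₂ (e , e′)) rewrite e | e′ = v—u

    lastEdge : ∃ λ i → (v ≡ lookup xs i × u ≡ lookup xs (next i))
                     ⊎ (v ≡ lookup xs (next i) × u ≡ lookup xs i)
    lastEdge with i , i≡ , e ← lookup-last path = i , inj₁ (sym e , sym (lookup-wrap path i i≡))

-- Quasi-kernels from a colouring

module Colouring
  {n : ℕ} (G : Digraph n) (p : Fin n → Fin n)
  (p⟶     : ∀ v → Digraph._⟶_ G (p v) v)
  (only-p : ∀ {u v} → Digraph._⟶_ G u v → u ≡ p v)
  (σ : Subset n)
  (σ-nonadjacent : ∀ {v} → v ∈ σ → p v ∉ σ)
  (c : Fin n → Fin 3)
  (c-plain   : ∀ {v} → v ∉ σ → c v ≡ next (c (p v)))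
  (c-doubled : ∀ {v} → v ∈ σ → c v ≡ next (next (c (p v))))
  where
  open Digraph G

  -- For a doubled v, c v ≡ next j says that its dummy has colour j.
  Q : Fin 3 → Subset n
  Q j = fibre c j ∪ (σ ∩ fibre c (next j))

  ∈Q-plain : ∀ {j v} → c v ≡ j → v ∈ Q j
  ∈Q-plain cv≡ = x∈p∪q⁺ (inj₁ (∈-fibre⁺ c cv≡))

  ∈Q-doubled : ∀ {j v} → v ∈ σ → c v ≡ next j → v ∈ Q j
  ∈Q-doubled v∈σ cv≡ = x∈p∪q⁺ (inj₂ (x∈p∩q⁺ (v∈σ , ∈-fibre⁺ c cv≡)))

  ∈Q⁻ : ∀ {j v} → v ∈ Q j → c v ≡ j ⊎ (v ∈ σ × c v ≡ next j)
  ∈Q⁻ {j} v∈ with x∈p∪q⁻ (fibre c j) _ v∈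
  ... | inj₁ v∈j = inj₁ (∈-fibre⁻ c v∈j)
  ... | inj₂ v∈′ with v∈σ , v∈j ← x∈p∩q⁻ σ _ v∈′ = inj₂ (v∈σ , ∈-fibre⁻ c v∈j)

  -- Since `p v` and `v` are not both doubled, they and their dummies are at most three consecutive
  -- vertices of the enlarged digraph, whose colours are distinct.
  ¬both : ∀ {j v} → p v ∈ Q j → ¬ (v ∈ Q j)
  ¬both {j} {v} pv∈ v∈ with ∈Q⁻ pv∈ | ∈Q⁻ v∈ | v ∈? σ
  ... | inj₂ (pv∈σ , _) | _          | yes v∈σ = σ-nonadjacent v∈σ pv∈σ
  ... | inj₂ _          | inj₂ (v∈σ , _) | no v∉σ = v∉σ v∈σ
  ... | inj₁ _          | inj₂ (v∈σ , _) | no v∉σ = v∉σ v∈σ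
  ... | inj₁ cpv≡       | inj₁ cv≡   | yes v∈σ =
    next²₃-≢ j (trans (sym cv≡) (trans (c-doubled v∈σ) (cong (next ∘ next) cpv≡)))
  ... | inj₁ cpv≡       | inj₂ (_ , cv≡) | yes v∈σ =
    next₃-≢ (next j) (trans (sym cv≡) (trans (c-doubled v∈σ) (cong (next ∘ next) cpv≡)))
  ... | inj₁ cpv≡       | inj₁ cv≡   | no v∉σ =
    next₃-≢ j (trans (sym cv≡) (trans (c-plain v∉σ) (cong next cpv≡)))
  ... | inj₂ (_ , cpv≡) | inj₁ cv≡   | no v∉σ =
    next²₃-≢ j (trans (sym cv≡) (trans (c-plain v∉σ) (cong next cpv≡)))

  -- Going back from `v` in the enlarged digraph, all three colours appear within two steps.
  -- Identifying a dummy with its doubled vertex only shortens the way.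
  covered : ∀ j v → v ∈ Q j ⊎ p v ∈ Q j ⊎ p (p v) ∈ Q j
  covered j v with next₃-cover (c v) j | v ∈? σ
  ... | inj₁ cv≡ | _ = inj₁ (∈Q-plain cv≡)
  ... | inj₂ (inj₁ cv≡) | yes v∈σ = inj₁ (∈Q-doubled v∈σ cv≡)
  ... | inj₂ (inj₁ cv≡) | no v∉σ =
    inj₂ (inj₁ (∈Q-plain (next₃-injective (trans (sym (c-plain v∉σ)) cv≡))))
  ... | inj₂ (inj₂ cv≡) | yes v∈σ =
    inj₂ (inj₁ (∈Q-plain (next₃-injective (next₃-injective (trans (sym (c-doubled v∈σ)) cv≡)))))
  ... | inj₂ (inj₂ cv≡) | no v∉σ with next₃-injective (trans (sym (c-plain v∉σ)) cv≡) | p v ∈? σ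
  -- Colour `j` is two steps back: it belongs to the dummy of `p v` if there is one, and to
  -- `p (p v)` otherwise.
  ...   | cpv≡ | yes pv∈σ = inj₂ (inj₁ (∈Q-doubled pv∈σ cpv≡))
  ...   | cpv≡ | no pv∉σ =
    inj₂ (inj₂ (∈Q-plain (next₃-injective (trans (sym (c-plain pv∉σ)) cpv≡))))

  Q-isQuasiKernel : ∀ j → IsQuasiKernel G (Q j)
  Q-isQuasiKernel j = record
    { independent = λ {u} u∈ v∈ u⟶v → ¬both (subst (_∈ Q j) (only-p u⟶v) u∈) v∈
    ; covers      = λ v → [ inj₁ , inj₂ ∘ [ (λ pv∈ → inj₁ (p v , pv∈ , p⟶ v))
                          , (λ ppv∈ → inj₂ (p v , (p (p v) , ppv∈ , p⟶ (p v)) , p⟶ v)) ]′ ]′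
                          (covered j v)
    }

  -- Each vertex counts once for its own colour, and a doubled one once more for the colour of its
  -- dummy. The shift by `next` merely permutes the three summands over `σ`.
  sum-∣Q∣ : ∣ Q 0F ∣ + ∣ Q 1F ∣ + ∣ Q 2F ∣ ≤ n + ∣ σ ∣
  sum-∣Q∣ = begin
    ∣ Q 0F ∣ + ∣ Q 1F ∣ + ∣ Q 2F ∣
      ≤⟨ +-mono-≤ (+-mono-≤ (bound 0F) (bound 1F)) (bound 2F) ⟩
    (f 0F + s 1F) + (f 1F + s 2F) + (f 2F + s 0F)
      ≡⟨ regroup (f 0F) (f 1F) (f 2F) (s 0F) (s 1F) (s 2F) ⟩
    (f 0F + f 1F + f 2F) + (s 0F + s 1F + s 2F)
      ≡⟨ cong₂ _+_ fibres-⊤ (sum-fibres σ c) ⟩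
    n + ∣ σ ∣ ∎
    where
    open ≤-Reasoning

    f s : Fin 3 → ℕ
    f j = ∣ fibre c j ∣
    s j = ∣ σ ∩ fibre c j ∣

    bound : ∀ j → ∣ Q j ∣ ≤ f j + s (next j)
    bound j = ∣p∪q∣≤∣p∣+∣q∣ (fibre c j) (σ ∩ fibre c (next j))

    regroup : ∀ a b c x y z → (a + y) + (b + z) + (c + x) ≡ (a + b + c) + (x + y + z)
    regroup = solve-∀

    ⊤∩ : ∀ j → ∣ ⊤ ∩ fibre c j ∣ ≡ f j
    ⊤∩ j = cong ∣_∣ (∩-identityˡ (fibre c j))

    fibres-⊤ : f 0F + f 1F + f 2F ≡ n
    fibres-⊤ = trans (sym (cong₂ _+_ (cong₂ _+_ (⊤∩ 0F) (⊤∩ 1F)) (⊤∩ 2F)))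
                     (trans (sum-fibres ⊤ c) (∣⊤∣≡n n))

  smallQuasiKernel : ∃ λ (K : Subset n) → IsQuasiKernel G K × 3 * ∣ K ∣ ≤ n + ∣ σ ∣
  smallQuasiKernel with min-of-three (∣ Q 0F ∣) (∣ Q 1F ∣) (∣ Q 2F ∣) sum-∣Q∣
  ... | inj₁ ≤n        = Q 0F , Q-isQuasiKernel 0F , ≤n
  ... | inj₂ (inj₁ ≤n) = Q 1F , Q-isQuasiKernel 1F , ≤n
  ... | inj₂ (inj₂ ≤n) = Q 2F , Q-isQuasiKernel 2F , ≤n

-- Climbing to a vertex r of the cycle

module Descent {n : ℕ} (p : Fin n → Fin n) where

  Parent : Rel (Fin n) 0ℓ
  Parent v u = u ≡ p v

  ancestor : ℕ → Fin n → Fin n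
  ancestor zero    v = v
  ancestor (suc t) v = ancestor t (p v)

  ancestor-+ : ∀ s t v → ancestor (s + t) v ≡ ancestor t (ancestor s v)
  ancestor-+ zero    t v = refl
  ancestor-+ (suc s) t v = ancestor-+ s t (p v)

  climb : ∀ t v → Star Parent v (ancestor t v)
  climb zero    v = ε
  climb (suc t) v = refl ◅ climb t (p v)

  -- Among the first n + 1 ancestors two coincide. The closed walk is recorded from `p x` back to
  -- `x`, so that it comprises at least one parent step even when the `Star` is empty.
  recurrentAncestor : ∀ v → ∃ λ x → Star Parent v x × Star Parent (p x) x
  recurrentAncestor v
    with i , j , i<j , e ← pigeonhole (n<1+n n) (λ (t : Fin (suc n)) → ancestor (toℕ t) v)
    with t , 1+i+t≡j ← m≤n⇒∃[o]m+o≡n i<j =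
    x , climb (toℕ i) v , subst (Star Parent (p x)) return (climb t (p x))
    where
    x : Fin n
    x = ancestor (toℕ i) v

    return : ancestor t (p x) ≡ x
    return = trans (sym (ancestor-+ (toℕ i) (suc t) v))
      (trans (cong (λ m → ancestor m v) (trans (+-suc (toℕ i) t) 1+i+t≡j)) (sym e))

  -- Total weight of the vertices met from `v` up to the first visit of `r`, with `r` itself left
  -- out. It is a relation because iterating `p` does not terminate; the condition `v ≢ r` makes its
  -- value unique.
  data Height (w : Fin n → ℕ) (r : Fin n) : ℕ → Fin n → Set where
    root  : Height w r 0 r
    below : ∀ {l v} → v ≢ r → Height w r l (p v) → Height w r (w v + l) v

  height : ∀ w {r v} → Star Parent v r → ∃ λ l → Height w r l v
  height w ε = 0 , root
  height w {r} {v} (refl ◅ walk) with v ≟ r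
  ... | yes refl = 0 , root
  ... | no v≢r with l , lev ← height w walk = w v + l , below v≢r lev

  height-unique : ∀ {w r l m v} → Height w r l v → Height w r m v → l ≡ m
  height-unique root          root            = refl
  height-unique root          (below r≢r _)   = contradiction refl r≢r
  height-unique (below r≢r _) root            = contradiction refl r≢r
  height-unique {w} {v = v} (below _ l) (below _ m) = cong (w v +_) (height-unique l m)

  weight : Subset n → Fin n → ℕ
  weight σ v with v ∈? σ
  ... | yes _ = 2
  ... | no _  = 1

  weight-doubled : ∀ σ {v} → v ∈ σ → weight σ v ≡ 2
  weight-doubled σ {v} v∈σ with v ∈? σ
  ... | yes _   = refl
  ... | no v∉σ = contradiction v∈σ v∉σ

  weight-plain : ∀ σ {v} → v ∉ σ → weight σ v ≡ 1
  weight-plain σ {v} v∉σ with v ∈? σ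
  ... | yes v∈σ = contradiction v∈σ v∉σ
  ... | no _    = refl

  Depth : Fin n → ℕ → Fin n → Set
  Depth = Height (λ _ → 1)

  below-weight : ∀ {w r l v k} → w v ≡ k → v ≢ r → Height w r l (p v) → Height w r (k + l) v
  below-weight refl = below

  below⁻ : ∀ {w r l v} → v ≢ r → Height w r l v → ∃ λ k → Height w r k (p v) × w v + k ≡ l
  below⁻ v≢r root        = contradiction refl v≢r
  below⁻ v≢r (below _ h) = _ , h , refl

  unweighted : ∀ {w r d v} → (∀ {x} → x ≢ r → w x ≡ 1) → Depth r d v → Height w r d v
  unweighted w≡1 root          = root
  unweighted w≡1 (below v≢r h) = below-weight (w≡1 v≢r) v≢r (unweighted w≡1 h)

  -- A vertex s cannot occur on the way from v to r if v is closer to r than s.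
  unweighted-below : ∀ {w r s m d v} →
    (∀ {x} → x ≢ r → x ≢ s → w x ≡ 1) →
    Depth r m s → d < m → Depth r d v → Height w r d v
  unweighted-below w≡1 hs d<m root = root
  unweighted-below w≡1 hs d<m hv@(below v≢r h) =
    below-weight (w≡1 v≢r λ { refl → <⇒≢ d<m (height-unique hv hs) })
      v≢r (unweighted-below w≡1 hs (<-trans (n<1+n _) d<m) h)

-- Reduction modulo 3, defined so that `residue (1 + l)` and `residue (2 + l)` unfold to one and two
-- applications of `next`.
residue : ℕ → Fin 3
residue zero    = 0F
residue (suc l) = next (residue l)

-- Choice of the doubled vertices

module Unicyclic
  {n : ℕ} (G : Digraph n) (p : Fin n → Fin n)
  (asymmetric : Asymmetric (Digraph._⟶_ G))
  (p⟶     : ∀ v → Digraph._⟶_ G (p v) v)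
  (only-p : ∀ {u v} → Digraph._⟶_ G u v → u ≡ p v)
  (r : Fin n) (reach : ∀ v → Star (Descent.Parent p) v r)
  where
  open Digraph G
  open Descent p

  p-≢ : ∀ v → p v ≢ v
  p-≢ v pv≡v = loopless pv≡v (p⟶ v)

  p²-≢ : ∀ v → p (p v) ≢ v
  p²-≢ v ppv≡v = asymmetric (p⟶ v) (subst (_⟶ p v) ppv≡v (p⟶ (p v)))

  -- The colour is the weighted height modulo 3. It advances correctly along every arc except
  -- possibly the one into `r`, where the height drops to 0; there the total weight of the cycle
  -- must be divisible by 3.
  fromDoubled : (σ : Subset n) → (∀ {v} → v ∈ σ → p v ∉ σ) →
    (∀ {l} → Height (weight σ) r l (p r) → residue (weight σ r + l) ≡ 0F) →
    ∃ λ (K : Subset n) → IsQuasiKernel G K × 3 * ∣ K ∣ ≤ n + ∣ σ ∣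
  fromDoubled σ nonadjacent closes = smallQuasiKernel
    where
    h : ∀ v → ∃ λ l → Height (weight σ) r l v
    h v = height (weight σ) (reach v)

    c : Fin n → Fin 3
    c v = residue (proj₁ (h v))

    c-step : ∀ v → c v ≡ residue (weight σ v + proj₁ (h (p v)))
    c-step v with v ≟ r
    ... | yes refl = trans (cong residue (height-unique (proj₂ (h r)) root))
                           (sym (closes (proj₂ (h (p r)))))
    ... | no v≢r   = cong residue (height-unique (proj₂ (h v)) (below v≢r (proj₂ (h (p v)))))

    c-weight : ∀ {v k} → weight σ v ≡ k → c v ≡ residue (k + proj₁ (h (p v)))
    c-weight {v} refl = c-step v

    open Colouring G p p⟶ only-p σ nonadjacent c
      (c-weight ∘ weight-plain σ) (c-weight ∘ weight-doubled σ)

  -- The cycle through r has length suc m.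
  byLength : ∀ {m} → Depth r m (p r) →
    ∃ λ (σ : Subset n) → ∣ σ ∣ ≤ 2 × (∀ {v} → v ∈ σ → p v ∉ σ)
      × (∀ {l} → Height (weight σ) r l (p r) → residue (weight σ r + l) ≡ 0F)
  byLength {m} d with residue (suc m) in res
  ... | 0F = ⊥ , ≤-trans (≤-reflexive (∣⊥∣≡0 n)) z≤n , (λ v∈⊥ _ → ∉⊥ v∈⊥) , closes
    where
    closes : ∀ {l} → Height (weight ⊥) r l (p r) → residue (weight ⊥ r + l) ≡ 0F
    closes h = trans
      (cong residue (cong₂ _+_ (weight-plain ⊥ {r} ∉⊥)
        (height-unique h (unweighted (λ _ → weight-plain ⊥ ∉⊥) d))))
      res
  ... | 2F = ⁅ r ⁆ , ≤-trans (≤-reflexive (∣⁅x⁆∣≡1 r)) (n≤1+n 1) , nonadjacent , closes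
    where
    nonadjacent : ∀ {v} → v ∈ ⁅ r ⁆ → p v ∉ ⁅ r ⁆
    nonadjacent v∈ pv∈ = p-≢ _ (trans (x∈⁅y⁆⇒x≡y r pv∈) (sym (x∈⁅y⁆⇒x≡y r v∈)))

    closes : ∀ {l} → Height (weight ⁅ r ⁆) r l (p r) → residue (weight ⁅ r ⁆ r + l) ≡ 0F
    closes h = trans
      (cong residue (cong₂ _+_ (weight-doubled ⁅ r ⁆ (x∈⁅x⁆ r))
        (height-unique h (unweighted (λ x≢r → weight-plain ⁅ r ⁆ (x≢y⇒x∉⁅y⁆ x≢r)) d))))
      -- The weight of the cycle is its length plus one, and `next 2F` is `0F`.
      (cong next res)
  ... | 1F = σ , small , nonadjacent , closes
    where
    s : Fin n
    -- The nearest candidate for a second doubled vertex, as `p r` is adjacent to `r`.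
    s = p (p r)

    σ : Subset n
    σ = ⁅ r ⁆ ∪ ⁅ s ⁆

    small : ∣ σ ∣ ≤ 2
    small = ≤-trans (∣p∪q∣≤∣p∣+∣q∣ ⁅ r ⁆ ⁅ s ⁆) (≤-reflexive (cong₂ _+_ (∣⁅x⁆∣≡1 r) (∣⁅x⁆∣≡1 s)))

    r∈σ : r ∈ σ
    r∈σ = x∈p∪q⁺ (inj₁ (x∈⁅x⁆ r))

    s∈σ : s ∈ σ
    s∈σ = x∈p∪q⁺ {p = ⁅ r ⁆} (inj₂ (x∈⁅x⁆ s))

    ∈σ⁻ : ∀ {v} → v ∈ σ → v ≡ r ⊎ v ≡ s
    ∈σ⁻ v∈ with x∈p∪q⁻ ⁅ r ⁆ ⁅ s ⁆ v∈
    ... | inj₁ v∈r = inj₁ (x∈⁅y⁆⇒x≡y r v∈r)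
    ... | inj₂ v∈s = inj₂ (x∈⁅y⁆⇒x≡y s v∈s)

    ∉σ : ∀ {v} → v ≢ r → v ≢ s → v ∉ σ
    ∉σ v≢r v≢s v∈ = [ v≢r , v≢s ]′ (∈σ⁻ v∈)

    -- Otherwise the cycle would be a triangle, whose length has residue `0F` and not `1F`.
    ps≢r : p s ≢ r
    ps≢r ps≡r = contradiction (trans (sym res) (cong (residue ∘ suc) m≡2)) λ ()
      where
      m≡2 : m ≡ 2
      m≡2 = height-unique d (below (p-≢ r) (below (p²-≢ r) (subst (Depth r 0) (sym ps≡r) root)))

    nonadjacent : ∀ {v} → v ∈ σ → p v ∉ σ
    nonadjacent v∈ pv∈ with ∈σ⁻ v∈ | ∈σ⁻ pv∈
    ... | inj₁ refl | inj₁ pr≡r = p-≢ r pr≡r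
    ... | inj₁ refl | inj₂ pr≡s = p-≢ (p r) (sym pr≡s)
    ... | inj₂ refl | inj₁ ps≡r = ps≢r ps≡r
    ... | inj₂ refl | inj₂ ps≡s = p-≢ s ps≡s

    pr-weight : weight σ (p r) ≡ 1
    pr-weight = weight-plain σ (∉σ (p-≢ r) (p-≢ (p r) ∘ sym))

    -- The way from `p r` passes `s` next, which adds one to the depth `m`. Beyond `s` every vertex
    -- is closer to `r` than `s`, so no doubled vertex recurs.
    doubled-height : Height (weight σ) r (suc m) (p r)
    doubled-height
      with m₁ , ds  , refl ← below⁻ (p-≢ r) d
      with m₂ , dps , refl ← below⁻ (p²-≢ r) ds =
      below-weight pr-weight (p-≢ r) (below-weight (weight-doubled σ s∈σ) (p²-≢ r)
        (unweighted-below (λ x≢r x≢s → weight-plain σ (∉σ x≢r x≢s)) ds (n<1+n m₂) dps))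

    closes : ∀ {l} → Height (weight σ) r l (p r) → residue (weight σ r + l) ≡ 0F
    closes h = trans
      (cong residue (cong₂ _+_ (weight-doubled σ r∈σ) (height-unique h doubled-height)))
      -- One extra unit comes from `r` and one from `s`, so two is added to the length of residue
      -- `1F`.
      (cong (next ∘ next) res)

  quasiKernel : ∃ λ (K : Subset n) → IsQuasiKernel G K × 3 * ∣ K ∣ ≤ n + 2
  quasiKernel with σ , ∣σ∣≤2 , nonadjacent , closes ← byLength (proj₂ (height _ (reach (p r))))
              with K , qk , size ← fromDoubled σ nonadjacent closes =
    K , qk , ≤-trans size (+-monoʳ-≤ n ∣σ∣≤2)

-- Structure of sourceless orientations of unicyclic graphs

nonempty : ∀ {n} (f : Fin n → Bool) → ∣ tabulate f ∣ ≢ 0 → ∃ λ i → f i ≡ true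
nonempty {zero}  f ≢0 = contradiction refl ≢0
nonempty {suc n} f ≢0 with f zero in f0
... | true  = zero , f0
... | false with i , fi ← nonempty (f ∘ suc) ≢0 = suc i , fi

module Structure
  {n : ℕ} (H : SimpleGraph n) (G : Digraph n)
  (orientation : IsOrientationOf G H)
  (unicyclic : ExactlyOneCycle H)
  (sourceless : ∀ v → ¬ IsSource G v)
  where
  open Digraph G
  open SimpleGraph H using (_—_)
  open IsOrientationOf orientation

  inNeighbour : ∀ v → ∃ (_⟶ v)
  inNeighbour v with nonempty (λ u → does (u ⟶? v)) (sourceless v)
  ... | u , e with u ⟶? v
  ...   | yes u⟶v = u , u⟶v
  inNeighbour v | u , () | no _

  p : Fin n → Fin n
  p v = proj₁ (inNeighbour v)

  p⟶ : ∀ v → p v ⟶ v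
  p⟶ v = proj₂ (inNeighbour v)

  open Descent p

  Parent⇒— : ∀ {u v} → Parent u v → u — v
  Parent⇒— {u} refl = SimpleGraph.symmetric H (arc⇒edge (p⟶ u))

  -- The closing edge joins `x` to its parent. Looplessness and asymmetry exclude orbits of length
  -- one and two, so this is a genuine cycle.
  orbit : ∀ {x} → Star Parent (p x) x → ClosedBy {R = Parent} H (p x) x
  orbit {x} = closeWalk H Parent⇒— (Parent⇒— refl)
    (λ px≡x → loopless px≡x (p⟶ x))
    (λ x≡ppx → asymmetric (p⟶ x) (subst (_⟶ p x) (sym x≡ppx) (p⟶ (p x))))

  transfer : (C D : Cycle H) → ∀ {u v} → Cycle.HasEdge C u v → Cycle.HasEdge D u v
  transfer C D {u} {v} =
    Equivalence.from (proj₂ unicyclic D u v) ∘ Equivalence.to (proj₂ unicyclic C u v)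

  -- Both orbits have the edges of the unique cycle. Hence `x` lies on the orbit of `y`, all of
  -- whose vertices are reached from `p y`.
  meet : ∀ {x y} → Star Parent (p x) x → Star Parent (p y) y → Star Parent (p y) x
  meet cx cy with transfer (ClosedBy.cycle (orbit cx)) (ClosedBy.cycle (orbit cy)) (ClosedBy.hasEdge (orbit cx))
  ... | i , inj₁ (refl , _) = ClosedBy.reachable (orbit cy) i
  ... | i , inj₂ (refl , _) = ClosedBy.reachable (orbit cy) (next i)

  someRecurrent : ∃ λ r → Star Parent (p r) r
  someRecurrent with proj₁ unicyclic
  -- The cycle of `H` supplies a vertex from which to start climbing.
  ... | record { len = suc _ ; vertex = vertex } with r , _ , cr ← recurrentAncestor (vertex zero) = r , cr

  r : Fin n
  r = proj₁ someRecurrent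

  reach : ∀ v → Star Parent v r
  reach v with x , v⇝x , cx ← recurrentAncestor v =
    v⇝x ◅◅ refl ◅ meet (proj₂ someRecurrent) cx

  Related : Rel (Fin n) 0ℓ
  Related u v = Parent u v ⊎ Parent v u

  -- The closing edge is no exception here, since it joins `r` to `p r`.
  orbit-edges : ∀ {u v} → Cycle.HasEdge (ClosedBy.cycle (orbit (proj₂ someRecurrent))) u v → Related u v
  orbit-edges (i , e) with ClosedBy.edges (orbit (proj₂ someRecurrent)) i
  orbit-edges (i , inj₁ (refl , refl)) | inj₁ par       = inj₁ par
  orbit-edges (i , inj₂ (refl , refl)) | inj₁ par       = inj₂ par
  orbit-edges (i , inj₁ (refl , refl)) | inj₂ (e , e′)  = inj₁ (trans e′ (cong p (sym e)))
  orbit-edges (i , inj₂ (refl , refl)) | inj₂ (e , e′)  = inj₂ (trans e′ (cong p (sym e)))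

  -- Any other arc would join two vertices of which neither is the chosen parent of the other.
  -- Together with a walk of parent edges through `r` it closes a cycle, which by uniqueness has the
  -- edges of the orbit of `r`; but those are all parent edges.
  only-p : ∀ {u v} → u ⟶ v → u ≡ p v
  only-p {u} {v} u⟶v with u ≟ p v
  ... | yes u≡pv = u≡pv
  ... | no u≢pv  = contradiction
    (orbit-edges (transfer cycle (ClosedBy.cycle (orbit (proj₂ someRecurrent))) hasEdge))
    [ u≢pv , v≢pu ]′
    where
    v≢pu : v ≢ p u
    v≢pu refl = asymmetric u⟶v (p⟶ u)

    walk : Star Related u v
    walk = mapStar inj₁ (reach u) ◅◅ reverseStar inj₂ (reach v)

    open ClosedBy (closeWalk H [ Parent⇒— , SimpleGraph.symmetric H ∘ Parent⇒— ]′
      (SimpleGraph.symmetric H (arc⇒edge u⟶v)) (λ u≡v → loopless u≡v u⟶v) [ v≢pu , u≢pv ]′ walk)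

  open Unicyclic G p asymmetric p⟶ only-p r reach public using (quasiKernel)

-- Lower bound on directed cycles

module Sharpness (n : ℕ) (3≤n : 3 ≤ n) (Q : Subset n) (qk : IsQuasiKernel (directedCycle n 3≤n) Q) where

  cover : Subset n
  cover = Q ∪ (image next Q ∪ image next (image next Q))

  ∈cover : ∀ v → v ∈ cover
  ∈cover v with IsQuasiKernel.covers qk v
  ... | inj₁ v∈ = x∈p∪q⁺ (inj₁ v∈)
  ... | inj₂ (inj₁ (u , u∈ , refl)) = x∈p∪q⁺ {p = Q} (inj₂ (x∈p∪q⁺ (inj₁ (∈-image next u∈))))
  ... | inj₂ (inj₂ (_ , (u , u∈ , refl) , refl)) =
    x∈p∪q⁺ {p = Q} (inj₂ (x∈p∪q⁺ {p = image next Q} (inj₂ (∈-image next (∈-image next u∈)))))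

  -- Out-neighbourhoods are images under `next`, hence no larger than the original set, and three
  -- such sets cover everything.
  n≤3∣Q∣ : n ≤ 3 * ∣ Q ∣
  n≤3∣Q∣ = begin
    n           ≡⟨ ∣⊤∣≡n n ⟨
    ∣ ⊤ {n} ∣   ≤⟨ p⊆q⇒∣p∣≤∣q∣ {p = ⊤ {n}} (λ {v} _ → ∈cover v) ⟩
    ∣ cover ∣   ≤⟨ ∣p∪q∣≤∣p∣+∣q∣ Q _ ⟩
    ∣ Q ∣ + ∣ image next Q ∪ image next (image next Q) ∣
                ≤⟨ +-monoʳ-≤ ∣ Q ∣ (∣p∪q∣≤∣p∣+∣q∣ (image next Q) _) ⟩
    ∣ Q ∣ + (∣ image next Q ∣ + ∣ image next (image next Q) ∣)
                ≤⟨ +-monoʳ-≤ ∣ Q ∣ (+-mono-≤ next≤ (≤-trans (∣image∣≤ next (image next Q)) next≤)) ⟩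
    ∣ Q ∣ + (∣ Q ∣ + ∣ Q ∣)
                ≡⟨ cong (λ k → ∣ Q ∣ + (∣ Q ∣ + k)) (sym (+-identityʳ ∣ Q ∣)) ⟩
    3 * ∣ Q ∣ ∎
    where
    open ≤-Reasoning

    next≤ : ∣ image next Q ∣ ≤ ∣ Q ∣
    next≤ = ∣image∣≤ next Q

roundUp : ∀ {n} q → n % 3 ≡ 1 → n ≤ 3 * q → n + 2 ≤ 3 * q
roundUp {n} q n%3≡1 n≤3q = begin
  n + 2             ≡⟨ cong (_+ 2) n≡ ⟩
  1 + n / 3 * 3 + 2 ≡⟨ regroup (n / 3) ⟩
  -- With n = 1 + 3k, the hypothesis n ≤ 3q reads 3k < 3q, so k < q.
  3 * suc (n / 3)   ≤⟨ *-monoʳ-≤ 3 (*-cancelˡ-< 3 (n / 3) q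
                         (subst (_≤ 3 * q) (trans n≡ (cong suc (*-comm (n / 3) 3))) n≤3q)) ⟩
  3 * q             ∎
  where
  open ≤-Reasoning

  n≡ : n ≡ 1 + n / 3 * 3
  n≡ = trans (m≡m%n+[m/n]*n n 3) (cong (_+ n / 3 * 3) n%3≡1)

  regroup : ∀ k → 1 + k * 3 + 2 ≡ 3 * suc k
  regroup = solve-∀

mainTheorem8 : ((n : ℕ) (H : SimpleGraph n) (G : Digraph n) →
    IsOrientationOf G H →
    Connected H →
    ExactlyOneCycle H →
    (∀ v → ¬ IsSource G v) →
    ∃ λ (Q : Subset n) → IsQuasiKernel G Q × 3 * ∣ Q ∣ ≤ n + 2)
    ×
    ((n : ℕ) (4≤n : 4 ≤ n) →
    n % 3 ≡ 1 →
    (Q : Subset n) →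
    IsQuasiKernel (directedCycle n (≤-trans (n≤1+n 3) 4≤n)) Q →
    ¬ (3 * ∣ Q ∣ < n + 2))
mainTheorem8 =
  (λ n H G orientation _ unicyclic sourceless → Structure.quasiKernel H G orientation unicyclic sourceless) ,
  (λ n 4≤n n%3≡1 Q qk → ≤⇒≯ (roundUp ∣ Q ∣ n%3≡1 (Sharpness.n≤3∣Q∣ n (≤-trans (n≤1+n 3) 4≤n) Q qk)))
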